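{- Let $1<t<m$ be integers, and let $t<p_1<p_2<\cdots<p_\ell$ be prime numbers such that $\prod_{i=1}^{\ell}p_i>n$. Then there is a deterministic $p_\ell$-pass catalytic streaming algorithm that, on every $t$-flat stream $\mathcal S=\langle x_1,\dots,x_m\rangle$ with items in $[n]$, returns $F_0(\mathcal S)=|\{i\in[n]:f_i\ne 0\}|$, and that uses $O(\ell\cdot p_\ell\cdot\log (m p_\ell)+\log n)$ bits of (clean) space.
   Context: A stream is a sequence $\mathcal S=\langle x_1,\dots,x_m\rangle$ with $x_i\in[n]=\{1,\dots,n\}$; $f_i$ is the number of occurrences of $i$ in the stream. The length $m$ is known to the algorithm in advance and $m\ge n$. A stream is $t$-flat if $f_i\le t$ for every $i\in[n]$. Catalytic streaming model: an algorithm has read-only access to the stream, which it scans sequentially from beginning to end in each pass; a workspace ("clean space") initialized to all zeros; and a catalytic memory initially containing an arbitrary string $z$. The algorithm may read and modify the catalytic memory during the computation but must restore it to exactly $z$ at the end, for every stream under consideration and every $z$, and its output must be correct for every such stream and every $z$. An $s$-space algorithm is one using $s$ bits of workspace. Space complexity refers to storage space (memory maintained between arrivals of consecutive stream items), not to the temporary memory used while processing a single item. -}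

module Defs where

open import Data.Bool using (Bool; false)
open import Data.Fin using (Fin; _≟_)
open import Data.Nat using (ℕ; _≤_)
import Data.Nat as ℕ
open import Data.Nat.GeneralisedArithmetic using (iterate)
open import Data.Product using (_×_; _,_; proj₂)
open import Data.Vec using (Vec; allFin; count; foldl′; replicate)
open import Relation.Binary.PropositionalEquality using (_≡_)
open import Relation.Nullary.Decidable using (¬?)

-- The universe [n] = {1, …, n} is represented by Fin n.
Stream : ℕ → ℕ → Set
Stream n m = Vec (Fin n) m

module _ {n m : ℕ} where

  freq : Stream n m → Fin n → ℕ
  freq S i = count (i ≟_) S

  Flat : ℕ → Stream n m → Set
  Flat t S = ∀ i → freq S i ≤ t

  F₀ : Stream n m → ℕ
  F₀ S = count (λ i → ¬? (freq S i ℕ.≟ 0)) (allFin n)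

-- The two memories are all that survives from one arrival to the next; in
-- particular the algorithm sees neither its position in the stream nor the
-- index of the current pass, so any such counter must be kept in memory.
-- Processing a single item is an arbitrary function, because temporary memory
-- used while processing an item is not charged.
record CatalyticStreamingAlgorithm (n : ℕ) : Set where
  field
    cleanBits     : ℕ
    catalyticBits : ℕ
    passes        : ℕ

  Config : Set
  Config = Vec Bool cleanBits × Vec Bool catalyticBits

  field
    step   : Fin n → Config → Config
    output : Config → ℕ

  pass : ∀ {m} → Stream n m → Config → Config
  pass S c = foldl′ (λ d x → step x d) c S

  run : ∀ {m} → Stream n m → Vec Bool catalyticBits → Config
  run S z = iterate (pass S) (replicate cleanBits false , z) passes

  Computes : ∀ {m} → (Stream n m → ℕ) → (Stream n m → Set) → Set
  Computes f P = ∀ S → P S → ∀ z →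
    (proj₂ (run S z) ≡ z) × (output (run S z) ≡ f S)

{-# OPTIONS --safe #-}

-- Each item i owns a register modulo N = 2 ^ b in the catalytic memory. Every
-- pass but the last adds f_i to it, so that it shows z_i + j f_i at the start of
-- pass j; the last pass subtracts everything again. For a prime q > f_i the
-- number of j < q with q ∣ z_i + j f_i is congruent to [f_i ≠ 0] modulo q. By
-- the Chinese remainder theorem these counts combine into one weighted count,
-- which gives F₀ modulo the product Q > n of the primes. This needs registers
-- that do not wrap around: a global shift s, read off the initial catalytic
-- content by pigeonhole and kept in clean memory, moves all registers away from
-- the end of the interval [0, N). Clean memory holds the arrival counter, s, and
-- the count modulo Q.
module Submission where

open import Defs
open import Data.Bool using (Bool; false; if_then_else_)
open import Data.Fin as Fin using (Fin; toℕ; combine; remQuot; funToFin; finToFun; _≟_)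
open import Data.Fin.Patterns using (0F; 1F; 2F)
open import Data.Fin.Properties
  using (2↔Bool; finToFun-funToFin; funToFin-finToFin; combine-remQuot; remQuot-combine;
         toℕ-fromℕ<; toℕ<n; toℕ-injective; toℕ-↑ˡ; any?; pigeonhole; ¬∀⟶∃¬)
open import Data.Nat hiding (_≟_)
import Data.Nat as ℕ
open import Data.Nat.Coprimality as Coprime
  using (Coprime; coprime-Bézout; coprime-divisor; prime⇒coprime)
open import Data.Nat.Divisibility
open import Data.Nat.DivMod
open import Data.Nat.GCD using (module Bézout)
open import Data.Nat.GeneralisedArithmetic using (iterate)
open import Data.Nat.Logarithm using (⌊log₂_⌋; ⌊log₂⌋-mono-≤; ⌊log₂[2^n]⌋≡n)
open import Data.Nat.Primality using (Prime; prime⇒nonZero)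
open import Data.Nat.Properties hiding (_≟_)
open import Data.Nat.Tactic.RingSolver using (solve-∀)
open import Data.Product using (Σ-syntax; ∃-syntax; _×_; _,_; proj₁; proj₂; uncurry)
open import Data.Sum using (inj₁; inj₂)
open import Data.Vec
  using (Vec; []; _∷_; foldr′; last; lookup; tabulate; replicate; count; allFin)
open import Data.Vec.Properties
  using (lookup∘tabulate; tabulate∘lookup; tabulate-cong; lookup-replicate; count≤n)
open import Data.Vec.Relation.Unary.All using (All; []; _∷_)
open import Data.Vec.Relation.Unary.Linked as Linked using (Linked; [-]; _∷_)
open import Data.Vec.Relation.Unary.Linked.Properties using (Linked⇒All)
open import Function using (_∘_; id; Inverse)
open import Relation.Binary.Definitions using (tri<; tri≈; tri>)
open import Relation.Binary.PropositionalEquality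
open import Relation.Nullary using (Dec; yes; no; ¬_; contradiction)
open import Relation.Nullary.Decidable using (¬?; _×-dec_; does; dec-true; dec-false)
open import Relation.Unary using (Decidable)
open import Algebra.Properties.Semiring.Sum +-*-semiring
  using (sum; sum-cong-≗; sum-replicate-zero; ∑-distrib-+; *-distribˡ-sum)
open CatalyticStreamingAlgorithm hiding (step; pass; run)

open Inverse 2↔Bool using ()
  renaming (to to toBool; from to fromBool; inverseˡ to toBool-fromBool; inverseʳ to fromBool-toBool)

-- Indicators and sums over the passes.

𝟙 : ∀ {a} {P : Set a} → Dec P → ℕ
𝟙 P? = if does P? then 1 else 0

module _ {a} {P : Set a} (P? : Dec P) where

  𝟙-true : P → 𝟙 P? ≡ 1
  𝟙-true p = cong (if_then 1 else 0) (dec-true P? p)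

  𝟙-false : ¬ P → 𝟙 P? ≡ 0
  𝟙-false ¬p = cong (if_then 1 else 0) (dec-false P? ¬p)

sumTo : ℕ → (ℕ → ℕ) → ℕ
sumTo zero    a = 0
sumTo (suc n) a = sumTo n a + a n

sumTo-cong : ∀ n {a b : ℕ → ℕ} → (∀ j → j < n → a j ≡ b j) → sumTo n a ≡ sumTo n b
sumTo-cong zero    eq = refl
sumTo-cong (suc n) eq = cong₂ _+_ (sumTo-cong n λ j j<n → eq j (m<n⇒m<1+n j<n)) (eq n ≤-refl)

sumTo-const : ∀ n c → sumTo n (λ _ → c) ≡ n * c
sumTo-const zero    c = refl
sumTo-const (suc n) c = trans (cong (_+ c) (sumTo-const n c)) (+-comm (n * c) c)

sumTo-zero : ∀ n {a : ℕ → ℕ} → (∀ j → j < n → a j ≡ 0) → sumTo n a ≡ 0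
sumTo-zero n eq = trans (sumTo-cong n eq) (trans (sumTo-const n 0) (*-zeroʳ n))

sumTo-truncate : ∀ {p} n {a : ℕ → ℕ} → p ≤ n → (∀ j → p ≤ j → a j ≡ 0) → sumTo n a ≡ sumTo p a
sumTo-truncate zero    z≤n  eq = refl
sumTo-truncate (suc n) p≤1+n eq with m≤n⇒m<n∨m≡n p≤1+n
... | inj₂ refl      = refl
... | inj₁ (s≤s p≤n) = trans (cong₂ _+_ (sumTo-truncate n p≤n eq) (eq n p≤n)) (+-identityʳ _)

sumTo-unique : ∀ n {a : ℕ → ℕ} j₀ → j₀ < n → a j₀ ≡ 1 →
               (∀ j → j < n → j ≢ j₀ → a j ≡ 0) → sumTo n a ≡ 1
sumTo-unique (suc n) j₀ j₀<1+n one others with m≤n⇒m<n∨m≡n (s≤s⁻¹ j₀<1+n)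
... | inj₂ refl = cong₂ _+_ (sumTo-zero n λ j j<n → others j (m<n⇒m<1+n j<n) (<⇒≢ j<n)) one
... | inj₁ j₀<n = cong₂ _+_
  (sumTo-unique n j₀ j₀<n one λ j j<n → others j (m<n⇒m<1+n j<n))
  (others n ≤-refl (>⇒≢ j₀<n))

sumTo-linear : ∀ n c d (a b : ℕ → ℕ) →
               sumTo n (λ j → c * a j + d * b j) ≡ c * sumTo n a + d * sumTo n b
sumTo-linear zero    c d a b = cong₂ _+_ (sym (*-zeroʳ c)) (sym (*-zeroʳ d))
sumTo-linear (suc n) c d a b =
  trans (cong (_+ (c * a n + d * b n)) (sumTo-linear n c d a b))
        (rearrange c d (sumTo n a) (sumTo n b) (a n) (b n))
  where
  rearrange : ∀ c d u v x y → c * u + d * v + (c * x + d * y) ≡ c * (u + x) + d * (v + y)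
  rearrange = solve-∀

-- Coprimality and Bézout's identity.

coprime-* : ∀ {p a b} → Coprime p a → Coprime p b → Coprime p (a * b)
coprime-* {p} {a} {b} p⊥a p⊥b {d} (d∣p , d∣ab) = p⊥b (d∣p , coprime-divisor d⊥a d∣ab)
  where
  d⊥a : Coprime d a
  d⊥a (e∣d , e∣a) = p⊥a (∣-trans e∣d d∣p , e∣a)

-- Bézout's identity with all terms non-negative, the price being a multiple of a b.
bézoutℕ : ∀ a b .{{_ : NonZero a}} .{{_ : NonZero b}} → Coprime a b →
          ∃[ u ] ∃[ v ] ∃[ w ] u * a + v * b ≡ 1 + a * b * w
bézoutℕ (suc a) (suc b) a⊥b with coprime-Bézout a⊥b
-- The pattern variable `a` is the predecessor of the modulus, so `y * a` stands for -y modulo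
-- `suc a`. Trading -y for it adds y times the product of both moduli, which is the third witness.
-- The other case is symmetric.
... | Bézout.+- x y eq = x , y * a , y , trans (cong (_+ y * a * suc b) (sym eq)) (lemma y a b)
  where
  lemma : ∀ y a b → 1 + y * (1 + b) + y * a * (1 + b) ≡ 1 + (1 + a) * (1 + b) * y
  lemma = solve-∀
... | Bézout.-+ x y eq = x * b , y , x , trans (cong (x * b * suc a +_) (sym eq)) (lemma x a b)
  where
  lemma : ∀ x a b → x * b * (1 + a) + (1 + x * (1 + a)) ≡ 1 + (1 + a) * (1 + b) * x
  lemma = solve-∀

-- Multiples of `p` in an arithmetic progression.

module _ {p f : ℕ} .{{_ : NonZero p}} (p⊥f : Coprime p f) (y : ℕ) where

  private
    -- Bézout bounds no index. Its remainder modulo `p` serves equally well, because the two terms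
    -- differ by a multiple of `p`.
    reduce : ∀ j → p ∣ y + j * f → ∃[ j ] j < p × p ∣ y + j * f
    reduce j p∣y+jf = j % p , m%n<n j p , ∣m+n∣m⇒∣n (subst (p ∣_) eq p∣y+jf) (n∣m*n (j / p * f))
      where
      lemma : ∀ y r q p f → y + (r + q * p) * f ≡ q * f * p + (y + r * f)
      lemma = solve-∀
      eq : y + j * f ≡ j / p * f * p + (y + j % p * f)
      eq = trans (cong (λ k → y + k * f) (m≡m%n+[m/n]*n j p)) (lemma y (j % p) (j / p) p f)

  -- The index sought is -y / f modulo `p`. In the first Bézout case `b` is already -1 / f; in the
  -- second it is 1 / f, and `p ∸ 1` supplies the sign.
  progression-hits : ∃[ j ] j < p × p ∣ y + j * f
  progression-hits with coprime-Bézout p⊥f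
  ... | Bézout.+- a b eq = reduce (b * y) (divides (a * y) (begin
      y + b * y * f    ≡⟨ lemma₁ y b f ⟩
      (1 + b * f) * y  ≡⟨ cong (_* y) eq ⟩
      a * p * y        ≡⟨ lemma₂ a p y ⟩
      a * y * p        ∎))
    where
    open ≡-Reasoning
    lemma₁ : ∀ y b f → y + b * y * f ≡ (1 + b * f) * y
    lemma₁ = solve-∀
    lemma₂ : ∀ a p y → a * p * y ≡ a * y * p
    lemma₂ = solve-∀
  ... | Bézout.-+ a b eq = reduce ((p ∸ 1) * b * y) (divides (y + (p ∸ 1) * a * y) (begin
      y + (p ∸ 1) * b * y * f                    ≡⟨ lemma₁ y (p ∸ 1) b f ⟩
      y + (p ∸ 1) * (b * f) * y                  ≡⟨ cong (λ k → y + (p ∸ 1) * k * y) eq ⟨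
      y + (p ∸ 1) * (1 + a * p) * y              ≡⟨ lemma₂ y (p ∸ 1) a p ⟩
      y * (1 + (p ∸ 1)) + (p ∸ 1) * a * y * p    ≡⟨ cong (λ k → y * k + (p ∸ 1) * a * y * p) (m+[n∸m]≡n (>-nonZero⁻¹ p)) ⟩
      y * p + (p ∸ 1) * a * y * p                ≡⟨ *-distribʳ-+ p y ((p ∸ 1) * a * y) ⟨
      (y + (p ∸ 1) * a * y) * p                  ∎))
    where
    open ≡-Reasoning
    lemma₁ : ∀ y c b f → y + c * b * y * f ≡ y + c * (b * f) * y
    lemma₁ = solve-∀
    lemma₂ : ∀ y c a p → y + c * (1 + a * p) * y ≡ y * (1 + c) + c * a * y * p
    lemma₂ = solve-∀

  private
    -- Subtracting two multiples of `p` would leave `f * (j ∸ i)`, so `p` would divide `j ∸ i`,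
    -- which is positive and smaller than `p`.
    ordered : ∀ {i j} → j < p → i < j → p ∣ y + i * f → ¬ p ∣ y + j * f
    ordered {i} {j} j<p i<j p∣i p∣j =
      >⇒∤ {{>-nonZero (m<n⇒0<n∸m i<j)}} (≤-<-trans (m∸n≤m j i) j<p)
        (coprime-divisor p⊥f (∣m+n∣m⇒∣n (subst (p ∣_) eq p∣j) p∣i))
      where
      lemma : ∀ y i d f → y + (d + i) * f ≡ y + i * f + f * d
      lemma = solve-∀
      eq : y + j * f ≡ y + i * f + f * (j ∸ i)
      eq = trans (cong (λ k → y + k * f) (sym (m∸n+n≡m (<⇒≤ i<j)))) (lemma y i (j ∸ i) f)

  progression-hits-once : ∀ {i j} → i < p → j < p → p ∣ y + i * f → p ∣ y + j * f → i ≡ j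
  progression-hits-once {i} {j} i<p j<p p∣i p∣j with <-cmp i j
  ... | tri< i<j _ _ = contradiction p∣j (ordered j<p i<j p∣i)
  ... | tri≈ _ i≡j _ = i≡j
  ... | tri> _ _ j<i = contradiction p∣i (ordered i<p j<i p∣j)

-- Weights that detect a nonzero frequency.

-- W j x is the weight of a register that shows x at the start of pass j.
Detects : (passes t Q : ℕ) → (ℕ → ℕ → ℕ) → Set
Detects P t Q W = ∀ y f → f ≤ t →
  ∃[ k ] sumTo P (λ j → W j (y + j * f)) ≡ 𝟙 (¬? (f ℕ.≟ 0)) + Q * k

-- For f ≠ 0 the values y + j f, j < p, run through all residues modulo p; for
-- f = 0 they are constant, so that a multiple of p is counted.
prime-detects : ∀ {P t p} → Prime p → t < p → p ≤ P →
                ∃[ W ] Detects P t p W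
prime-detects {P} {t} {p} p-prime t<p p≤P = W , detects
  where
  instance _ = prime⇒nonZero p-prime

  -- All primes share the same `P` passes. The condition `j < p` confines this prime to the first
  -- `p` of them, one full period of residues.
  hit? : ∀ j x → Dec (j < p × p ∣ x)
  hit? j x = j <? p ×-dec p ∣? x

  W : ℕ → ℕ → ℕ
  W j x = 𝟙 (hit? j x)

  truncate : ∀ (x : ℕ → ℕ) → sumTo P (λ j → W j (x j)) ≡ sumTo p (λ j → W j (x j))
  truncate x = sumTo-truncate P p≤P λ j p≤j → 𝟙-false (hit? j (x j)) λ (j<p , _) → <⇒≱ j<p p≤j

  y+j*0≡y : ∀ y j → y + j * 0 ≡ y
  y+j*0≡y y j = trans (cong (y +_) (*-zeroʳ j)) (+-identityʳ y)

  detects : Detects P t p W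
  detects y zero _ with p ∣? y
  ... | yes p∣y = 1 , (begin
      sumTo P (λ j → W j (y + j * 0))  ≡⟨ truncate _ ⟩
      sumTo p (λ j → W j (y + j * 0))  ≡⟨ sumTo-cong p (λ j j<p → 𝟙-true (hit? j _) (j<p , subst (p ∣_) (sym (y+j*0≡y y j)) p∣y)) ⟩
      sumTo p (λ _ → 1)                ≡⟨ sumTo-const p 1 ⟩
      p * 1                            ∎)
    where
    open ≡-Reasoning
  ... | no p∤y = 0 , trans (sumTo-zero P λ j _ → 𝟙-false (hit? j _) λ (_ , p∣) → p∤y (subst (p ∣_) (y+j*0≡y y j) p∣)) (sym (*-zeroʳ p))
  detects y f@(suc _) f≤t = 0 , (begin
      sumTo P (λ j → W j (y + j * f))  ≡⟨ truncate _ ⟩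
      sumTo p (λ j → W j (y + j * f))  ≡⟨ once ⟩
      1                                ≡⟨ cong (1 +_) (*-zeroʳ p) ⟨
      1 + p * 0                        ∎)
    where
    open ≡-Reasoning
    p⊥f : Coprime p f
    p⊥f = prime⇒coprime p-prime (≤-<-trans f≤t t<p)
    once : sumTo p (λ j → W j (y + j * f)) ≡ 1
    once with j₀ , j₀<p , p∣ ← progression-hits p⊥f y =
      sumTo-unique p j₀ j₀<p (𝟙-true (hit? j₀ _) (j₀<p , p∣)) λ j j<p j≢j₀ →
        𝟙-false (hit? j _) λ (_ , p∣′) → j≢j₀ (progression-hits-once p⊥f y j<p j₀<p p∣′ p∣)

-- Both counts are congruent to the same indicator i, one modulo `a` and one modulo `b`. The factors
-- v b and u a turn both errors into multiples of a b and leave (u a + v b) i, which is i modulo a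
-- b. Combining the weights pointwise means that a single accumulator suffices for all primes.
coprime-detects : ∀ P {t a b} .{{_ : NonZero a}} .{{_ : NonZero b}} → Coprime a b →
                  ∃[ W ] Detects P t a W → ∃[ W ] Detects P t b W → ∃[ W ] Detects P t (a * b) W
coprime-detects P {t} {a} {b} a⊥b (V , V-detects) (W , W-detects)
  with u , v , w , eq ← bézoutℕ a b a⊥b = U , detects
  where
  U : ℕ → ℕ → ℕ
  U j x = v * b * V j x + u * a * W j x

  detects : Detects P t (a * b) U
  detects y f f≤t with k , V-eq ← V-detects y f f≤t | l , W-eq ← W-detects y f f≤t =
    w * i + v * k + u * l , (begin
      sumTo P (λ j → U j (y + j * f))            ≡⟨ sumTo-linear P (v * b) (u * a) _ _ ⟩
      v * b * sumTo P (λ j → V j (y + j * f)) + u * a * sumTo P (λ j → W j (y + j * f))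
                                                 ≡⟨ cong₂ (λ s r → v * b * s + u * a * r) V-eq W-eq ⟩
      v * b * (i + a * k) + u * a * (i + b * l)  ≡⟨ lemma₁ u v a b i k l ⟩
      (u * a + v * b) * i + a * b * (v * k + u * l) ≡⟨ cong (λ e → e * i + a * b * (v * k + u * l)) eq ⟩
      (1 + a * b * w) * i + a * b * (v * k + u * l) ≡⟨ lemma₂ (a * b) w i (v * k) (u * l) ⟩
      i + a * b * (w * i + v * k + u * l)        ∎)
    where
    open ≡-Reasoning
    i = 𝟙 (¬? (f ℕ.≟ 0))
    lemma₁ : ∀ u v a b i k l → v * b * (i + a * k) + u * a * (i + b * l)
                             ≡ (u * a + v * b) * i + a * b * (v * k + u * l)
    lemma₁ = solve-∀
    lemma₂ : ∀ q w i k l → (1 + q * w) * i + q * (k + l) ≡ i + q * (w * i + k + l)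
    lemma₂ = solve-∀

-- Detection modulo the product of the primes.

∏ : ∀ {l} → Vec ℕ l → ℕ
∏ = foldr′ _*_ 1

∏-nonZero : ∀ {l} {p : Vec ℕ l} → All Prime p → NonZero (∏ p)
∏-nonZero []                                 = _
∏-nonZero {p = p ∷ ps} (p-prime ∷ ps-prime) = m*n≢0 p (∏ ps) {{prime⇒nonZero p-prime}} {{∏-nonZero ps-prime}}

-- A nonzero number below a prime is coprime to it, so the strict increase of the primes is all that
-- is used of their distinctness.
coprime-∏ : ∀ {l q} {p : Vec ℕ l} → Prime q → All Prime p → All (q <_) p → Coprime q (∏ p)
coprime-∏ _  []               []           (_ , d∣1) = ∣1⇒≡1 d∣1
coprime-∏ q-prime (p-prime ∷ ps-prime) (q<p ∷ q<ps) = coprime-*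
  (Coprime.sym (prime⇒coprime p-prime {{prime⇒nonZero q-prime}} q<p))
  (coprime-∏ q-prime ps-prime q<ps)

linked⇒all : ∀ {l v} {p : Vec ℕ l} → Linked _<_ (v ∷ p) → All (v <_) p
linked⇒all [-]       = []
linked⇒all {p = _ ∷ _} (v<p ∷ linked) = Linked⇒All <-trans v<p linked

∏-detects : ∀ {l P t} {p : Vec ℕ (suc l)} → All Prime p → Linked _<_ p → All (t <_) p → All (_≤ P) p →
            ∃[ W ] Detects P t (∏ p) W
∏-detects {P = P} {t} {p ∷ []} (p-prime ∷ []) _ (t<p ∷ []) (p≤P ∷ []) =
  subst (λ Q → ∃[ W ] Detects P t Q W) (sym (*-identityʳ p)) (prime-detects p-prime t<p p≤P)
∏-detects {P = P} {p = p ∷ ps@(_ ∷ _)} (p-prime ∷ ps-prime) linked (t<p ∷ t<ps) (p≤P ∷ ps≤P) =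
  coprime-detects P {{prime⇒nonZero p-prime}} {{∏-nonZero ps-prime}}
    (coprime-∏ p-prime ps-prime (linked⇒all linked))
    (prime-detects p-prime t<p p≤P)
    (∏-detects ps-prime (Linked.tail linked) t<ps ps≤P)

-- Arrays of registers encoded in bits.

funToFin-cong : ∀ {m n} {f g : Fin m → Fin n} → f ≗ g → funToFin f ≡ funToFin g
funToFin-cong {zero}  eq = refl
funToFin-cong {suc m} eq = cong₂ combine (eq 0F) (funToFin-cong (eq ∘ Fin.suc))

module _ (b : ℕ) {w : ℕ} where

  read : Vec Bool (w * b) → Fin w → Fin (2 ^ b)
  read v i = funToFin λ j → fromBool (lookup v (combine i j))

  write : (Fin w → Fin (2 ^ b)) → Vec Bool (w * b)
  write g = tabulate (uncurry (λ i j → toBool (finToFun (g i) j)) ∘ remQuot b)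

  read-write : ∀ g i → read (write g) i ≡ g i
  read-write g i = trans (funToFin-cong bit) (funToFin-finToFin {b} (g i))
    where
    open ≡-Reasoning
    bit : ∀ j → fromBool (lookup (write g) (combine i j)) ≡ finToFun (g i) j
    bit j = begin
      fromBool (lookup (write g) (combine i j))
        ≡⟨ cong fromBool (lookup∘tabulate _ (combine i j)) ⟩
      fromBool (uncurry (λ i j → toBool (finToFun (g i) j)) (remQuot b (combine i j)))
        ≡⟨ cong (fromBool ∘ uncurry (λ i j → toBool (finToFun (g i) j))) (remQuot-combine i j) ⟩
      fromBool (toBool (finToFun (g i) j))
        ≡⟨ fromBool-toBool refl ⟩
      finToFun (g i) j ∎

  -- Every bit string encodes an array, so an arbitrary initial catalytic string is a legitimate
  -- array of registers.
  write-read : ∀ v → write (read v) ≡ v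
  write-read v = trans (tabulate-cong bit) (tabulate∘lookup v)
    where
    open ≡-Reasoning
    bit : ∀ k → uncurry (λ i j → toBool (finToFun (read v i) j)) (remQuot b k) ≡ lookup v k
    bit k = let i , j = remQuot {w} b k in begin
      toBool (finToFun (read v i) j)
        ≡⟨ cong toBool (finToFun-funToFin _ j) ⟩
      toBool (fromBool (lookup v (combine i j)))
        ≡⟨ toBool-fromBool refl ⟩
      lookup v (combine i j)
        ≡⟨ cong (lookup v) (combine-remQuot {w} b k) ⟩
      lookup v k ∎

  -- Reduces restoring the catalytic string to restoring the value of each register.
  read-injective : ∀ {u v} → read u ≗ read v → u ≡ v
  read-injective {u} {v} eq = trans (sym (write-read u)) (trans (tabulate-cong λ k →
    cong (λ r → toBool (finToFun r (proj₂ (remQuot {w} b k)))) (eq (proj₁ (remQuot b k)))) (write-read v))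

toℕ-funToFin-zero : ∀ b → toℕ (funToFin {b} {2} (λ _ → 0F)) ≡ 0
toℕ-funToFin-zero zero    = refl
toℕ-funToFin-zero (suc b) = trans (toℕ-↑ˡ (funToFin {b} {2} (λ _ → 0F)) (2 ^ b + 0)) (toℕ-funToFin-zero b)

-- Makes the zeroed clean space start the clock and the accumulator at 0.
read-zeros : ∀ b {w} i → toℕ (read b {w} (replicate (w * b) false) i) ≡ 0
read-zeros b i = trans
  (cong toℕ (funToFin-cong {b} λ j → cong fromBool (lookup-replicate (combine i j) false)))
  (toℕ-funToFin-zero b)

-- Remainders, double sums and the pigeonhole shift.

toℕ-mod : ∀ x d .{{_ : NonZero d}} → toℕ (x mod d) ≡ x % d
toℕ-mod x d = toℕ-fromℕ< (m%n<n x d)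

%-+-absorbˡ : ∀ a b d .{{_ : NonZero d}} → (a % d + b) % d ≡ (a + b) % d
%-+-absorbˡ a b d = begin
  (a % d + b) % d          ≡⟨ %-distribˡ-+ (a % d) b d ⟩
  (a % d % d + b % d) % d  ≡⟨ cong (λ c → (c + b % d) % d) (m%n%n≡m%n a d) ⟩
  (a % d + b % d) % d      ≡⟨ %-distribˡ-+ a b d ⟨
  (a + b) % d              ∎
  where open ≡-Reasoning

count-tabulate : ∀ {a p} {A : Set a} {P : A → Set p} (P? : Decidable P) {n} (g : Fin n → A) →
                 count P? (tabulate g) ≡ sum (λ i → 𝟙 (P? (g i)))
count-tabulate P? {zero}  g = refl
count-tabulate P? {suc n} g with P? (g 0F)
... | yes _ = cong suc (count-tabulate P? (g ∘ Fin.suc))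
... | no  _ = count-tabulate P? (g ∘ Fin.suc)

count-∷ : ∀ {a p} {A : Set a} {P : A → Set p} (P? : Decidable P) {n} x (xs : Vec A n) →
          count P? (x ∷ xs) ≡ 𝟙 (P? x) + count P? xs
count-∷ P? x xs with P? x
... | yes _ = refl
... | no  _ = refl

-- The algorithm tallies all registers pass by pass, whereas `Detects` speaks of one register across
-- all passes.
sumTo-sum : ∀ k {n} (g : ℕ → Fin n → ℕ) →
            sumTo k (λ j → sum (g j)) ≡ sum (λ i → sumTo k (λ j → g j i))
sumTo-sum zero    {n} g = sym (sum-replicate-zero n)
sumTo-sum (suc k) g = trans (cong (_+ sum (g k)) (sumTo-sum k g)) (sym (∑-distrib-+ _ (g k)))

-- If every value were hit, choosing preimages would map `Fin H` into the smaller `Fin n`, and a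
-- collision of preimages would identify two distinct values.
missed : ∀ {n H} → n < H → (h : Fin n → Fin H) → ∃[ v ] ∀ i → h i ≢ v
missed {n} {H} n<H h = let v , ¬hit = ¬∀⟶∃¬ H (λ v → ∃[ i ] h i ≡ v) (λ v → any? λ i → h i ≟ v) ¬onto
                       in v , λ i hi≡v → ¬hit (i , hi≡v)
  where
  ¬onto : ¬ (∀ v → ∃[ i ] h i ≡ v)
  ¬onto onto with v , w , v<w , eq ← pigeonhole n<H (proj₁ ∘ onto) =
    <⇒≢ v<w (cong toℕ (trans (sym (proj₂ (onto v))) (trans (cong h eq) (proj₂ (onto w)))))

-- Cutting the cycle ℤ/(H L) into H > n blocks of length L, some block contains no
-- z i; the shift moves this block to the end.
gap-shift : ∀ {n N} H L .{{_ : NonZero N}} .{{_ : NonZero L}} → N ≡ H * L → n < H →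
            (z : Fin n → ℕ) → (∀ i → z i < N) →
            ∃[ s ] s < N × (∀ i → (z i + s) % N + L ≤ N)
gap-shift {n} {N} H L refl n<H z z<N = s , s<N , bound
  where
  open ≤-Reasoning
  block : Fin n → Fin H
  block i = Fin.fromℕ< (m<n*o⇒m/o<n (z<N i))
  free = missed n<H block
  e = toℕ (proj₁ free)
  -- Adding `s` carries the upper end of the free block `e` to `N`.
  s = N ∸ suc e * L
  e+1≤N : suc e * L ≤ N
  e+1≤N = *-monoˡ-≤ L (toℕ<n (proj₁ free))
  s<N : s < N
  s<N = ∸-monoʳ-< (≤-trans (>-nonZero⁻¹ L) (m≤m+n L (e * L))) e+1≤N
  avoids : ∀ i → z i / L ≢ e
  avoids i eq = proj₂ free i (toℕ-injective (trans (toℕ-fromℕ< _) eq))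
  bound : ∀ i → (z i + s) % N + L ≤ N
  -- A value below the free block lands at or below N - L without wrapping. A value inside it is
  -- excluded. A value above it wraps around to its distance from the end of the block.
  bound i with z i <? e * L | z i <? suc e * L
  ... | yes z<eL | _ = begin
    (z i + s) % N + L  ≤⟨ +-monoˡ-≤ L (m%n≤m (z i + s) N) ⟩
    z i + s + L        ≤⟨ +-monoˡ-≤ L (+-monoˡ-≤ s (<⇒≤ z<eL)) ⟩
    e * L + s + L      ≡⟨ trans (+-comm (e * L + s) L) (sym (+-assoc L (e * L) s)) ⟩
    suc e * L + s      ≡⟨ m+[n∸m]≡n e+1≤N ⟩
    N                  ∎
  ... | no z≮eL | yes z<eL+L = contradiction
    (≤-antisym (s≤s⁻¹ (m<n*o⇒m/o<n z<eL+L)) (subst (_≤ z i / L) (m*n/n≡m e L) (/-monoˡ-≤ L (≮⇒≥ z≮eL))))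
    (avoids i)
  ... | no _ | no z≮eL+L = begin
    (z i + s) % N + L              ≡⟨ cong (λ x → (x + s) % N + L) (m∸n+n≡m (≮⇒≥ z≮eL+L)) ⟨
    (d + suc e * L + s) % N + L    ≡⟨ cong (λ x → x % N + L) (trans (+-assoc d _ s) (cong (d +_) (m+[n∸m]≡n e+1≤N))) ⟩
    (d + N) % N + L                ≡⟨ cong (_+ L) ([m+n]%n≡m%n d N) ⟩
    d % N + L                      ≤⟨ +-mono-≤ (m%n≤m d N) (m≤m+n L (e * L)) ⟩
    d + suc e * L                  ≡⟨ m∸n+n≡m (≮⇒≥ z≮eL+L) ⟩
    z i                            ≤⟨ <⇒≤ (z<N i) ⟩
    N                              ∎
    where d = z i ∸ suc e * L

-- The algorithm.

select : ∀ {a} {A : Set a} → ℕ → A → A → A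
select zero    x y = x
select (suc _) x y = y

module Algorithm (n m P b Q : ℕ) .{{_ : NonZero m}} .{{_ : NonZero Q}}
                 (W : ℕ → ℕ → ℕ) (choose : (Fin n → Fin (2 ^ b)) → ℕ) where

  N = 2 ^ b

  instance
    N-nonZero : NonZero N
    N-nonZero = m^n≢0 2 b

  Clean Catalytic : Set
  Clean     = Vec Bool (3 * b)
  Catalytic = Vec Bool (n * b)

  clock storedShift accumulator : Clean → ℕ
  clock       c = toℕ (read b {3} c 0F)
  storedShift c = toℕ (read b {3} c 1F)
  accumulator c = toℕ (read b {3} c 2F)

  register : Catalytic → Fin n → ℕ
  register z i = toℕ (read b z i)

  -- Before the first arrival, the shift about to be chosen and stored.
  shift : Clean × Catalytic → ℕ
  shift (c , z) = select (clock c) (choose (read b z)) (storedShift c)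

  -- (N ∸ 1) (P ∸ 1) ≡ − (P ∸ 1) modulo N, so the last pass undoes all the others.
  increment : ℕ → ℕ
  increment j = if does (suc j <? P) then 1 else (N ∸ 1) * (P ∸ 1)

  -- The shift is applied to the values inspected and never to the memory, so it leaves nothing to
  -- undo.
  tally : ℕ → ℕ → (Fin n → ℕ) → ℕ
  tally j s r = sum λ i → W j ((r i + s) % N)

  step : Fin n → Clean × Catalytic → Clean × Catalytic
  step x (c , z) =
    write b (λ k → lookup (suc τ ∷ s ∷ a ∷ []) k mod N) ,
    write b (λ i → (register z i + increment (τ / m) * 𝟙 (i ≟ x)) mod N)
    where
    -- The clock counts arrivals over all passes: `τ / m` is the current pass and `τ % m` the
    -- position in it.
    τ = clock c
    s = shift (c , z)
    -- Only the first arrival of a pass tallies, and it does so on the contents before its own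
    -- update, when all registers still show their values at the start of the pass.
    a = select (τ % m) ((accumulator c + tally (τ / m) s (register z)) % Q) (accumulator c)

  algorithm : CatalyticStreamingAlgorithm n
  algorithm = record
    { cleanBits     = 3 * b
    ; catalyticBits = n * b
    ; passes        = P
    ; step          = step
    ; output        = accumulator ∘ proj₁
    }

  -- The invariant along arrivals and passes.

  open CatalyticStreamingAlgorithm algorithm using (pass; run)

  -- `a` and `r` are ideal unreduced values, of which memory holds the residues. The field `shift≡`
  -- speaks of `shift` instead of `storedShift`, so that the invariant already holds before the
  -- first arrival.
  record State (τ s a : ℕ) (r : Fin n → ℕ) (c : Clean × Catalytic) : Set where
    field
      clock≡       : clock (proj₁ c) ≡ τ
      shift≡       : shift c ≡ s
      accumulator≡ : accumulator (proj₁ c) ≡ a % Q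
      register≡    : ∀ i → register (proj₂ c) i ≡ r i % N

  module _ (mP<N : m * P < N) (Q≤N : Q ≤ N) {s} (s<N : s < N) where

    open State

    -- The enclosing bounds make the clock, the shift and the reduced accumulator fit into `b` bits
    -- each, so writing them modulo `N` loses nothing. Registers are tracked modulo `N` only.
    step-state : ∀ {τ a r c} x → τ < m * P → State τ s a r c →
                 State (suc τ) s (a + select (τ % m) (tally (τ / m) s r) 0)
                       (λ i → r i + increment (τ / m) * 𝟙 (i ≟ x)) (step x c)
    step-state {τ} {a} {r} {c , z} x τ<mP
      record { clock≡ = refl ; shift≡ = refl ; accumulator≡ = a≡ ; register≡ = r≡ } = record
      { clock≡       = clock′
      -- The new clock is a successor, so from here on the stored shift is the one consulted.
      ; shift≡       = trans (cong (λ k → select k (choose (read b (proj₂ c′))) (storedShift (proj₁ c′))) clock′) (field≡ 1F s<N)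
      ; accumulator≡ = trans (field≡ 2F (<-≤-trans (subst (_< Q) (sym acc′) (m%n<n _ Q)) Q≤N)) acc′
      ; register≡    = λ i → begin
          register (proj₂ c′) i
            ≡⟨ trans (cong toℕ (read-write b _ i)) (toℕ-mod _ N) ⟩
          (register z i + d i) % N
            ≡⟨ cong (λ y → (y + d i) % N) (r≡ i) ⟩
          (r i % N + d i) % N
            ≡⟨ %-+-absorbˡ (r i) (d i) N ⟩
          (r i + d i) % N ∎
      }
      where
      open ≡-Reasoning
      c′ = step x (c , z)
      d : Fin n → ℕ
      d i = increment (τ / m) * 𝟙 (i ≟ x)
      fields : Vec ℕ 3
      fields = suc τ ∷ s ∷ select (τ % m) ((accumulator c + tally (τ / m) s (register z)) % Q) (accumulator c) ∷ []
      field≡ : ∀ k → lookup fields k < N → toℕ (read b (proj₁ c′) k) ≡ lookup fields k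
      field≡ k <N = trans (cong toℕ (read-write b _ k)) (trans (toℕ-mod _ N) (m<n⇒m%n≡m <N))
      clock′ : clock (proj₁ c′) ≡ suc τ
      clock′ = field≡ 0F (≤-<-trans τ<mP mP<N)
      tally≡ : tally (τ / m) s (register z) ≡ tally (τ / m) s r
      tally≡ = sum-cong-≗ λ i → cong (W (τ / m)) (trans (cong (λ y → (y + s) % N) (r≡ i)) (%-+-absorbˡ (r i) s N))
      acc′ : lookup fields 2F ≡ (a + select (τ % m) (tally (τ / m) s r) 0) % Q
      acc′ with τ % m
      ... | zero  = trans (cong₂ (λ u v → (u + v) % Q) a≡ tally≡) (%-+-absorbˡ a _ Q)
      ... | suc _ = trans a≡ (cong (_% Q) (sym (+-identityʳ a)))

    State-cong : ∀ {τ τ′ a a′ r r′ c} → τ ≡ τ′ → a ≡ a′ → r ≗ r′ → State τ s a r c → State τ′ s a′ r′ c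
    State-cong refl refl r≗ st = record
      { clock≡       = clock≡ st
      ; shift≡       = shift≡ st
      ; accumulator≡ = accumulator≡ st
      ; register≡    = λ i → trans (register≡ st i) (cong (_% N) (r≗ i))
      }

    module _ {j} (j<P : j < P) where

      private
        clock<mP : ∀ {k} → k < m → k + j * m < m * P
        clock<mP k<m = <-≤-trans (+-monoˡ-< (j * m) k<m) (subst (suc j * m ≤_) (*-comm P m) (*-monoˡ-≤ m j<P))

        clock/m : ∀ {k} → k < m → (k + j * m) / m ≡ j
        clock/m {k} k<m = trans (+-distrib-/-∣ʳ k (n∣m*n j)) (cong₂ _+_ (m<n⇒m/n≡0 k<m) (m*n/n≡m j m))

        clock%m : ∀ {k} → k < m → (k + j * m) % m ≡ k
        clock%m {k} k<m = trans ([m+kn]%n≡m%n k j m) (m<n⇒m%n≡m k<m)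

      arrival-state : ∀ {k a r c} x → k < m → State (k + j * m) s a r c →
                      State (suc k + j * m) s (a + select k (tally j s r) 0)
                            (λ i → r i + increment j * 𝟙 (i ≟ x)) (step x c)
      arrival-state {k} {a} {r} x k<m st = State-cong refl
        (cong₂ (λ u v → a + select u (tally v s r) 0) (clock%m k<m) (clock/m k<m))
        (λ i → cong (λ v → r i + increment v * 𝟙 (i ≟ x)) (clock/m k<m))
        (step-state x (clock<mP k<m) st)

      private
        count-step : ∀ {l} (r : Fin n → ℕ) x (xs : Vec (Fin n) l) i →
                     r i + increment j * 𝟙 (i ≟ x) + increment j * count (i ≟_) xs
                     ≡ r i + increment j * count (i ≟_) (x ∷ xs)
        count-step r x xs i = begin
          r i + d * 𝟙 (i ≟ x) + d * count (i ≟_) xs    ≡⟨ +-assoc (r i) _ _ ⟩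
          r i + (d * 𝟙 (i ≟ x) + d * count (i ≟_) xs)  ≡⟨ cong (r i +_) (*-distribˡ-+ d (𝟙 (i ≟ x)) _) ⟨
          r i + d * (𝟙 (i ≟ x) + count (i ≟_) xs)      ≡⟨ cong (λ f → r i + d * f) (count-∷ (i ≟_) x xs) ⟨
          r i + d * count (i ≟_) (x ∷ xs)              ∎
          where
          open ≡-Reasoning
          d = increment j

      -- The position `suc k` is nonzero, so no tally occurs and `a` stays fixed. The equation with
      -- `m` makes the clock end exactly at the next pass.
      later-arrivals-state : ∀ {l} (xs : Vec (Fin n) l) {k a r c} → suc k + l ≡ m →
                             State (suc k + j * m) s a r c →
                             State (suc j * m) s a (λ i → r i + increment j * count (i ≟_) xs) (pass xs c)
      later-arrivals-state [] {k} {a} {r} k+l≡m = State-cong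
        (cong (_+ j * m) (trans (sym (+-identityʳ (suc k))) k+l≡m))
        refl
        (λ i → sym (trans (cong (r i +_) (*-zeroʳ (increment j))) (+-identityʳ (r i))))
      later-arrivals-state {suc l} (x ∷ xs) {k} {a} {r} k+l≡m st =
        State-cong refl refl (count-step r x xs)
          (later-arrivals-state xs (trans (sym (+-suc (suc k) l)) k+l≡m)
            (State-cong refl (+-identityʳ a) (λ _ → refl)
              (arrival-state x (subst (suc k <_) k+l≡m (m<m+n (suc k) z<s)) st)))

      -- The separate length `l` allows matching on the stream while `m`, by which the clock is
      -- divided, stays fixed.
      pass-state : ∀ {l} (S : Vec (Fin n) l) {a r c} → l ≡ m → State (j * m) s a r c →
                   State (suc j * m) s (a + tally j s r) (λ i → r i + increment j * freq S i) (pass S c)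
      pass-state []       refl = contradiction refl (≢-nonZero⁻¹ m)
      pass-state (x ∷ xs) {r = r} l≡m st =
        State-cong refl refl (count-step r x xs)
          (later-arrivals-state xs l≡m (arrival-state x (subst (0 <_) l≡m z<s) st))

    module _ (S : Stream n m) (z : Catalytic) where

      registerAfter : ℕ → Fin n → ℕ
      registerAfter j i = register z i + sumTo j increment * freq S i

      tallied : ℕ → ℕ
      tallied j = sumTo j λ j′ → tally j′ s (registerAfter j′)

      -- `iterate` applies the pass to its start value first, so the induction is on the `k` passes
      -- still to come, after `j` completed ones.
      passes-state : ∀ k {j c} → k + j ≡ P → State (j * m) s (tallied j) (registerAfter j) c →
                     State (P * m) s (tallied P) (registerAfter P) (iterate (pass S) c k)
      passes-state zero    refl st = st
      passes-state (suc k) {j} eq st = passes-state k (trans (+-suc k j) eq)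
        (State-cong refl refl lemma (pass-state (subst (j <_) eq (s≤s (m≤n+m j k))) S refl st))
        where
        lemma : ∀ i → registerAfter j i + increment j * freq S i ≡ registerAfter (suc j) i
        lemma i = trans (+-assoc (register z i) _ _)
          (cong (register z i +_) (sym (*-distribʳ-+ (freq S i) (sumTo j increment) (increment j))))

      run-state : choose (read b z) ≡ s → State (P * m) s (tallied P) (registerAfter P) (run S z)
      run-state choice = passes-state P (+-identityʳ P) record
        { clock≡       = read-zeros b {3} 0F
        ; shift≡       = trans (cong (λ k → select k (choose (read b z)) (storedShift (replicate (3 * b) false))) (read-zeros b {3} 0F)) choice
        ; accumulator≡ = trans (read-zeros b {3} 2F) (sym (m<n⇒m%n≡m (>-nonZero⁻¹ Q)))
        ; register≡    = λ i → sym (trans (cong (_% N) (+-identityʳ (register z i))) (m<n⇒m%n≡m (toℕ<n (read b z i))))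
        }

  -- Restoration of the registers and correctness of the output.

  sumTo-increment : ∀ {j} → j < P → sumTo j increment ≡ j
  sumTo-increment {j} j<P = begin
    sumTo j increment    ≡⟨ sumTo-cong j (λ i i<j → cong (if_then 1 else (N ∸ 1) * (P ∸ 1)) (dec-true (suc i <? P) (≤-<-trans i<j j<P))) ⟩
    sumTo j (λ _ → 1)    ≡⟨ sumTo-const j 1 ⟩
    j * 1                ≡⟨ *-identityʳ j ⟩
    j                    ∎
    where open ≡-Reasoning

  -- The total being a multiple of `N`, each register returns to its initial residue whatever the
  -- frequency of its item.
  sumTo-increment-all : ∀ {p} → P ≡ suc p → sumTo P increment ≡ p * N
  sumTo-increment-all {p} refl = begin
    sumTo p increment + increment p  ≡⟨ cong₂ _+_ (sumTo-increment ≤-refl)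
                                                  (cong (if_then 1 else (N ∸ 1) * (P ∸ 1)) (dec-false (suc p <? P) (<-irrefl refl))) ⟩
    p + (N ∸ 1) * p                  ≡⟨ cong (_* p) (m+[n∸m]≡n (>-nonZero⁻¹ N)) ⟩
    N * p                            ≡⟨ *-comm N p ⟩
    p * N                            ∎
    where open ≡-Reasoning

  module _ {t : ℕ} .{{_ : NonZero P}} (mP<N : m * P < N) (Q≤N : Q ≤ N) (n<Q : n < Q) (W-detects : Detects P t Q W)
           (choose<N : ∀ r → choose r < N)
           (choose-gap : ∀ r i → (toℕ (r i) + choose r) % N + P * t < N) where

    computes-F₀ : Computes algorithm {m} F₀ (Flat t)
    computes-F₀ S flat z = restored , correct
      where
      open ≡-Reasoning

      s = choose (read b z)
      s<N = choose<N (read b z)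

      tallied′ : ℕ
      tallied′ = tallied mP<N Q≤N s<N S z P

      final : State (P * m) s tallied′ (registerAfter mP<N Q≤N s<N S z P) (run S z)
      final = run-state mP<N Q≤N s<N S z refl

      restored : proj₂ (run S z) ≡ z
      restored = read-injective b λ i → toℕ-injective (begin
        register (proj₂ (run S z)) i
          ≡⟨ State.register≡ final i ⟩
        (register z i + sumTo P increment * freq S i) % N
          ≡⟨ cong (λ d → (register z i + d * freq S i) % N) (sumTo-increment-all (sym (suc-pred P))) ⟩
        (register z i + pred P * N * freq S i) % N
          ≡⟨ cong (λ d → (register z i + d) % N) (lemma (pred P) N (freq S i)) ⟩
        (register z i + pred P * freq S i * N) % N
          ≡⟨ [m+kn]%n≡m%n (register z i) (pred P * freq S i) N ⟩
        register z i % N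
          ≡⟨ m<n⇒m%n≡m (toℕ<n (read b z i)) ⟩
        register z i ∎)
        where
        lemma : ∀ p N f → p * N * f ≡ p * f * N
        lemma = solve-∀

      y : Fin n → ℕ
      y i = (register z i + s) % N

      -- Flatness bounds the drift j f_i by P t, for which the shift has left room below `N`. The
      -- last pass is included, since its tally precedes its subtraction.
      no-wraparound : ∀ {j} → j < P → ∀ i → (register z i + sumTo j increment * freq S i + s) % N ≡ y i + j * freq S i
      no-wraparound {j} j<P i = begin
        (register z i + sumTo j increment * freq S i + s) % N  ≡⟨ cong (λ d → (register z i + d * freq S i + s) % N) (sumTo-increment j<P) ⟩
        (register z i + j * freq S i + s) % N                  ≡⟨ cong (_% N) (lemma (register z i) (j * freq S i) s) ⟩
        (register z i + s + j * freq S i) % N                  ≡⟨ %-+-absorbˡ (register z i + s) _ N ⟨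
        (y i + j * freq S i) % N                               ≡⟨ m<n⇒m%n≡m (≤-<-trans (+-monoʳ-≤ (y i) (*-mono-≤ (<⇒≤ j<P) (flat i))) (choose-gap (read b z) i)) ⟩
        y i + j * freq S i                                     ∎
        where
        lemma : ∀ a b c → a + b + c ≡ a + c + b
        lemma = solve-∀

      present : Fin n → ℕ
      present i = 𝟙 (¬? (freq S i ℕ.≟ 0))

      k : Fin n → ℕ
      k i = proj₁ (W-detects (y i) (freq S i) (flat i))

      F₀-sum : F₀ S ≡ sum present
      F₀-sum = count-tabulate (λ i → ¬? (freq S i ℕ.≟ 0)) id

      total : tallied′ ≡ F₀ S + sum k * Q
      total = begin
        sumTo P (λ j → tally j s (λ i → register z i + sumTo j increment * freq S i))
          ≡⟨ sumTo-cong P (λ j j<P → sum-cong-≗ λ i → cong (W j) (no-wraparound j<P i)) ⟩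
        sumTo P (λ j → sum λ i → W j (y i + j * freq S i))
          ≡⟨ sumTo-sum P (λ j i → W j (y i + j * freq S i)) ⟩
        sum (λ i → sumTo P λ j → W j (y i + j * freq S i))
          ≡⟨ sum-cong-≗ (λ i → proj₂ (W-detects (y i) (freq S i) (flat i))) ⟩
        sum (λ i → present i + Q * k i)
          ≡⟨ ∑-distrib-+ present (λ i → Q * k i) ⟩
        sum present + sum (λ i → Q * k i)
          ≡⟨ cong₂ _+_ F₀-sum (*-distribˡ-sum Q k) ⟨
        F₀ S + Q * sum k
          ≡⟨ cong (F₀ S +_) (*-comm Q (sum k)) ⟩
        F₀ S + sum k * Q ∎

      correct : accumulator (proj₁ (run S z)) ≡ F₀ S
      correct = begin
        accumulator (proj₁ (run S z))  ≡⟨ State.accumulator≡ final ⟩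
        tallied′ % Q                   ≡⟨ cong (_% Q) total ⟩
        (F₀ S + sum k * Q) % Q         ≡⟨ [m+kn]%n≡m%n (F₀ S) (sum k) Q ⟩
        -- At most n < Q items are present, so the residue determines the count.
        F₀ S % Q                       ≡⟨ m<n⇒m%n≡m (≤-<-trans (count≤n _ (allFin n)) n<Q) ⟩
        F₀ S                           ∎

-- Choice of parameters and the space bound.

m<2^[1+⌊log₂m⌋] : ∀ m → m < 2 ^ suc ⌊log₂ m ⌋
m<2^[1+⌊log₂m⌋] m = ≰⇒> λ 2^≤m → 1+n≰n (subst (_≤ ⌊log₂ m ⌋) (⌊log₂[2^n]⌋≡n (suc ⌊log₂ m ⌋)) (⌊log₂⌋-mono-≤ 2^≤m))

∏≤^ : ∀ {l P} {p : Vec ℕ l} → All (_≤ P) p → ∏ p ≤ P ^ l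
∏≤^ []           = ≤-refl
∏≤^ (p≤P ∷ ps≤P) = *-mono-≤ p≤P (∏≤^ ps≤P)

all≤last : ∀ {l} {p : Vec ℕ (suc l)} → Linked _<_ p → All (_≤ last p) p
all≤last [-] = ≤-refl ∷ []
all≤last {p = p ∷ q ∷ ps} (p<q ∷ linked) with q≤P ∷ ps≤P ← all≤last linked =
  ≤-trans (<⇒≤ p<q) q≤P ∷ q≤P ∷ ps≤P

module Instance (n m t k : ℕ) (p : Vec ℕ (suc k)) (n≤m : n ≤ m) (1<t : 1 < t) (t<m : t < m)
                (p-prime : All Prime p) (linked : Linked _<_ (t ∷ p)) (n<∏p : n < ∏ p) where

  open ≤-Reasoning

  P = last p
  Λ = ⌊log₂ (m * P) ⌋
  -- `H` is a power of two above m P, hence above n, and serves as the number of blocks. The block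
  -- length `L` exceeds the drift, as P t ≤ m P < H, and also bounds the product of the `suc k`
  -- primes, each at most P < H. Then `b` is set so that 2 ^ b is H L.
  H = 2 ^ suc Λ
  L = H ^ suc k
  b = suc (suc k) * suc Λ

  p≤P : All (_≤ P) p
  p≤P = all≤last (Linked.tail linked)

  t<P : t < P
  t<P with t<p ∷ _ ← linked⇒all linked | p≤P ∷ _ ← p≤P = <-≤-trans t<p p≤P

  0<m : 0 < m
  0<m = ≤-<-trans z≤n t<m

  0<P : 0 < P
  0<P = ≤-<-trans z≤n t<P

  instance
    m-nonZero : NonZero m
    m-nonZero = >-nonZero 0<m
    P-nonZero : NonZero P
    P-nonZero = >-nonZero 0<P
    Q-nonZero : NonZero (∏ p)
    Q-nonZero = ∏-nonZero p-prime
    N-nonZero : NonZero (2 ^ b)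
    N-nonZero = m^n≢0 2 b
    H-nonZero : NonZero H
    H-nonZero = m^n≢0 2 (suc Λ)
    L-nonZero : NonZero L
    L-nonZero = m^n≢0 H (suc k)

  mP<H : m * P < H
  mP<H = m<2^[1+⌊log₂m⌋] (m * P)

  N≡HL : 2 ^ b ≡ H * L
  N≡HL = trans (cong (2 ^_) (*-comm (suc (suc k)) (suc Λ))) (sym (^-*-assoc 2 (suc Λ) (suc (suc k))))

  H≤L : H ≤ L
  H≤L = m≤m*n H (H ^ k) {{m^n≢0 H k}}

  L≤N : L ≤ 2 ^ b
  L≤N = subst (L ≤_) (sym N≡HL) (m≤n*m L H)

  mP<N : m * P < 2 ^ b
  mP<N = <-≤-trans mP<H (≤-trans H≤L L≤N)

  Q≤N : ∏ p ≤ 2 ^ b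
  Q≤N = begin
    ∏ p        ≤⟨ ∏≤^ p≤P ⟩
    P ^ suc k  ≤⟨ ^-monoˡ-≤ (suc k) (≤-trans (m≤n*m P m) (<⇒≤ mP<H)) ⟩
    L          ≤⟨ L≤N ⟩
    2 ^ b      ∎

  n<H : n < H
  n<H = ≤-<-trans (≤-trans n≤m (m≤m*n m P)) mP<H

  Pt<L : P * t < L
  Pt<L = begin-strict
    P * t  ≤⟨ *-monoʳ-≤ P (<⇒≤ t<m) ⟩
    P * m  ≡⟨ *-comm P m ⟩
    m * P  <⟨ mP<H ⟩
    H      ≤⟨ H≤L ⟩
    L      ∎

  weights = ∏-detects {P = P} {t} p-prime (Linked.tail linked) (linked⇒all linked) p≤P

  shift-choice : (r : Fin n → Fin (2 ^ b)) →
                 ∃[ s ] s < 2 ^ b × (∀ i → (toℕ (r i) + s) % 2 ^ b + L ≤ 2 ^ b)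
  shift-choice r = gap-shift H L N≡HL n<H (toℕ ∘ r) (toℕ<n ∘ r)

  open Algorithm n m P b (∏ p) (proj₁ weights) (proj₁ ∘ shift-choice) public hiding (N-nonZero)

  choose<N : ∀ r → proj₁ (shift-choice r) < 2 ^ b
  choose<N r = proj₁ (proj₂ (shift-choice r))

  choose-gap : ∀ r i → (toℕ (r i) + proj₁ (shift-choice r)) % 2 ^ b + P * t < 2 ^ b
  choose-gap r i = <-≤-trans (+-monoʳ-< _ Pt<L) (proj₂ (proj₂ (shift-choice r)) i)

  1≤Λ : 1 ≤ Λ
  1≤Λ = ⌊log₂⌋-mono-≤ {2} {m * P} (≤-trans 1<t (≤-trans (<⇒≤ t<m) (m≤m*n m P)))

  bits : 3 * b ≤ 12 * (suc k * P * Λ + ⌊log₂ n ⌋)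
  bits = begin
    -- Both successors are absorbed by doubling, for `Λ` because m P is at least 2. With the three
    -- fields of clean memory this gives the constant 12.
    3 * (suc (suc k) * suc Λ)            ≤⟨ *-monoʳ-≤ 3 (*-mono-≤ k+2≤ Λ+1≤) ⟩
    3 * (2 * suc k * (2 * Λ))            ≡⟨ lemma (suc k) Λ ⟩
    12 * (suc k * Λ)                     ≤⟨ *-monoʳ-≤ 12 (*-monoˡ-≤ Λ (m≤m*n (suc k) P)) ⟩
    12 * (suc k * P * Λ)                 ≤⟨ *-monoʳ-≤ 12 (m≤m+n (suc k * P * Λ) ⌊log₂ n ⌋) ⟩
    12 * (suc k * P * Λ + ⌊log₂ n ⌋)     ∎
    where
    1+n≤2n : ∀ n → 1 ≤ n → suc n ≤ 2 * n
    1+n≤2n n 1≤n = subst (suc n ≤_) (cong (n +_) (sym (+-identityʳ n))) (+-monoˡ-≤ n 1≤n)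
    k+2≤ : suc (suc k) ≤ 2 * suc k
    k+2≤ = 1+n≤2n (suc k) z<s
    Λ+1≤ : suc Λ ≤ 2 * Λ
    Λ+1≤ = 1+n≤2n Λ 1≤Λ
    lemma : ∀ k Λ → 3 * (2 * k * (2 * Λ)) ≡ 12 * (k * Λ)
    lemma = solve-∀

  computes : Computes algorithm {m} F₀ (Flat t)
  computes = computes-F₀ {t} mP<N Q≤N n<∏p (proj₂ weights) choose<N choose-gap

theorem27 : ∃[ C ] ∀ (n m t k : ℕ) (p : Vec ℕ (suc k)) →
    n ≤ m → 1 < t → t < m →
    All Prime p → Linked _<_ (t ∷ p) → n < foldr′ _*_ 1 p →
    Σ[ A ∈ CatalyticStreamingAlgorithm n ]
    (passes A ≡ last p)
    × (cleanBits A ≤ C * (suc k * last p * ⌊log₂ (m * last p) ⌋ + ⌊log₂ n ⌋))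
    × (Computes A {m} F₀ (Flat t))
theorem27 = 12 , λ n m t k p n≤m 1<t t<m p-prime linked n<∏p →
  let open Instance n m t k p n≤m 1<t t<m p-prime linked n<∏p in
  algorithm , refl , bits , computes
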